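{- Let $n\ge 2$ and let $a_1,\dots,a_n$ be commuting indeterminates. Let $C$ be the $n\times n$ tridiagonal matrix with diagonal entries $C_{ii}=a_i$ for $1\le i\le n$, with $C_{i,i+1}=C_{i+1,i}=1$ for $1\le i\le n-1$, and with all other entries $0$. Let $E$ be the $n\times n$ skew-symmetric matrix with $E_{1n}=1$, $E_{n1}=-1$, and all other entries $0$. Then the determinant of the $2n\times 2n$ skew-symmetric matrix $$\Omega=\begin{pmatrix} E & C\\ -C & E\end{pmatrix}$$ satisfies $$\det(\Omega)=R_n(a_1,\dots,a_n)^2,$$ where $R_n$ is the rotundus polynomial; that is, $R_n$ is (up to sign) the Pfaffian of $\Omega$.
   Context: The continuant $K_n(a_1,\dots,a_n)$ is the determinant of the $n\times n$ tridiagonal matrix with diagonal entries $a_1,\dots,a_n$, all entries immediately above and below the diagonal equal to $1$, and all other entries $0$; by convention $K_0=1$ and $K_{ -1}=0$. The rotundus is the polynomial $R_n(a_1,\dots,a_n):=K_n(a_1,\dots,a_n)-K_{n-2}(a_2,\dots,a_{n-1})$. The determinant of a skew-symmetric matrix $\Omega$ is the square of a polynomial $\mathrm{pf}(\Omega)$ in its entries, called its Pfaffian; here it is understood through $\det(\Omega)=\mathrm{pf}(\Omega)^2$, i.e. up to sign. -}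

module Defs where

open import Algebra.Bundles using (CommutativeRing)
open import Data.Bool.Base using (if_then_else_)
open import Data.Fin.Base using (Fin; zero; suc; toℕ; fromℕ)
open import Data.Fin.Properties using (_≟_)
open import Data.Nat.Base using (ℕ; zero; suc; _+_; ∣_-_∣)
open import Data.Vec.Functional
  using (Vector; head; tail; init; map; zipWith; removeAt; _++_)
open import Relation.Nullary.Decidable.Core using (does)

module Rotundus {c ℓ} (R : CommutativeRing c ℓ) where

  open CommutativeRing R
    using (Carrier; _≈_; _*_; _-_; -_; 0#; 1#; semiring)
  open import Algebra.Properties.Semiring.Sum semiring using (sum)
  open import Algebra.Properties.Semiring.Exp semiring public using (_^_)

  Matrix : ℕ → ℕ → Set c
  Matrix m n = Vector (Vector Carrier n) m

  mapᴹ : (Carrier → Carrier) → ∀ {m n} → Matrix m n → Matrix m n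
  mapᴹ f M = map (map f) M

  -- Cofactor expansion along the first row.
  det : ∀ {n} → Matrix n n → Carrier
  det {zero}  M = 1#
  det {suc n} M = sum λ j →
    ((- 1#) ^ toℕ j) * (head M j * det (map (λ row → removeAt row j) (tail M)))

  block : ∀ {m n p q} → Matrix m p → Matrix m q →
          Matrix n p → Matrix n q → Matrix (m + n) (p + q)
  block A B C D = zipWith _++_ A B ++ zipWith _++_ C D

  tridiagonal : ∀ {n} → Vector Carrier n → Matrix n n
  tridiagonal a i j with ∣ toℕ i - toℕ j ∣
  ... | 0           = a i
  ... | 1           = 1#
  ... | suc (suc _) = 0#

  continuant : ∀ {n} → Vector Carrier n → Carrier
  continuant a = det (tridiagonal a)

  -- The subtracted continuant is that of a₂, …, aₙ₋₁.
  rotundus : ∀ {m} → Vector Carrier (2 + m) → Carrier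
  rotundus a = continuant a - continuant (init (tail a))

  corner : ∀ m → Matrix (2 + m) (2 + m)
  corner m zero    j       = if does (j ≟ fromℕ (suc m)) then 1# else 0#
  corner m (suc i) zero    = if does (suc i ≟ fromℕ (suc m)) then - 1# else 0#
  corner m (suc i) (suc j) = 0#

  Ω : ∀ {m} → Vector Carrier (2 + m) → Matrix ((2 + m) + (2 + m)) ((2 + m) + (2 + m))
  Ω {m} a = block (corner m)                         (tridiagonal a)
                  (mapᴹ (λ x → - x) (tridiagonal a)) (corner m)

  SkewSymmetric : ∀ {n} → Matrix n n → Set ℓ
  SkewSymmetric M = ∀ i j → M i j ≈ - M j i

{-# OPTIONS --safe #-}

-- Write Ω with blocks E, C, −C, E. Over a ring containing w with w² = −1, adding w times
-- the lower rows to the upper ones and −w times the left columns to the right ones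
-- turns Ω into a block lower triangular matrix with diagonal blocks
-- E − wC = −w (C + wE) and E + wC = w (C − wE). Since −w is a square root of −1 too, it is
-- enough that det (C + wE) = Kₙ + w² Kₙ₋₂ = Rₙ, which follows by linearity in the first row
-- and the first column: the two terms of degree one in w are cofactors of the symmetric
-- matrix C and cancel. A general ring R is embedded in R[x]/(x² + 1).

module Submission where

open import Defs
open import Algebra.Bundles using (AbelianGroup; CommutativeRing)
import Algebra.Construct.DirectProduct as DirectProduct
open import Algebra.Morphism.Structures using (IsRingHomomorphism)
open import Data.Bool.Base using (true; false; if_then_else_)
open import Data.Fin.Base using (Fin; zero; suc; toℕ; fromℕ; inject₁; lift; punchIn; splitAt; _↑ˡ_; _↑ʳ_)
open import Data.Fin.Properties using (_≟_; toℕ-↑ˡ; toℕ-inject₁; toℕ-injective)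
open import Data.Nat.Base as ℕ using (ℕ; zero; suc; ∣_-_∣)
open import Data.Nat.Properties using (∣-∣-comm; ∣m-n∣≡0⇒m≡n)
open import Data.Product.Base using (_×_; _,_; proj₁)
open import Data.Sum.Base using (inj₁; inj₂)
open import Data.Sum.Properties using ([,]-map)
open import Data.Vec.Functional
  using (Vector; _∷_; _++_; head; tail; init; zipWith; removeAt; transpose)
open import Data.Vec.Functional.Properties using (lookup-++ˡ; lookup-++ʳ)
open import Function.Base using (_∘_; id)
open import Relation.Binary.PropositionalEquality.Core as ≡ using (_≡_; _≗_)
open import Relation.Nullary.Decidable.Core using (does)

-- Index maps and concatenation of vectors.

punchIn-fromℕ : ∀ {n} (i : Fin n) → punchIn (fromℕ n) i ≡ inject₁ i
punchIn-fromℕ zero    = ≡.refl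
punchIn-fromℕ (suc i) = ≡.cong suc (punchIn-fromℕ i)

module _ {a} {A : Set a} where

  tail-++ : ∀ {p q} (xs : Vector A (suc p)) (ys : Vector A q) →
            tail (xs ++ ys) ≗ tail xs ++ ys
  tail-++ {p} xs ys i = [,]-map (splitAt p i)

  -- For minors of block matrices: striking out a column of the left half leaves the right half
  -- intact, so the minor is a block matrix again.
  removeAt-++ : ∀ {p q} (xs : Vector A (suc p)) (ys : Vector A q) j →
                removeAt (xs ++ ys) (j ↑ˡ q) ≗ removeAt xs j ++ ys
  removeAt-++ xs ys zero l = tail-++ xs ys l
  removeAt-++ {suc p} xs ys (suc j) zero = ≡.refl
  removeAt-++ {suc p} xs ys (suc j) (suc l) =
    ≡.trans (tail-++ xs ys (punchIn (j ↑ˡ _) l))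
   (≡.trans (removeAt-++ (tail xs) ys j l)
            (≡.sym (tail-++ (removeAt xs (suc j)) ys l)))

-- Signs, finite sums and the expansion along the first row.

module Determinant {c ℓ} (R : CommutativeRing c ℓ) where

  open CommutativeRing R hiding (zero)
  open Rotundus R
  open import Algebra.Properties.Ring ring
    using (-1*x≈-x; -‿involutive; +-inverseˡ-unique; -0#≈0#)
  open import Algebra.Properties.Semiring.Exp semiring using (^-congʳ)
  import Algebra.Properties.Semiring.Sum semiring as Sum
  open import Algebra.Solver.Ring.NaturalCoefficients.Default commutativeSemiring
    using (solve; _:=_; _:+_; _:*_; con)
  open import Relation.Binary.Reasoning.Setoid setoid

  -1²≈1 : - 1# * - 1# ≈ 1#
  -1²≈1 = trans (-1*x≈-x (- 1#)) (-‿involutive 1#)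

  ^-inverse : ∀ {x y} → x * y ≈ 1# → ∀ n → x ^ n * y ^ n ≈ 1#
  ^-inverse xy≈1 zero = *-identityˡ 1#
  ^-inverse {x} {y} xy≈1 (suc n) = begin
    (x * x ^ n) * (y * y ^ n)  ≈⟨ solve 4 (λ a b c d → (a :* b) :* (c :* d) := (a :* c) :* (b :* d)) refl _ _ _ _ ⟩
    (x * y) * (x ^ n * y ^ n)  ≈⟨ *-cong xy≈1 (^-inverse xy≈1 n) ⟩
    1# * 1#                    ≈⟨ *-identityˡ 1# ⟩
    1#                         ∎

  -- Opaque, because sums, powers and determinants of successor size otherwise unfold
  -- eagerly during unification.
  opaque
    ∑ : ∀ {n} → Vector Carrier n → Carrier
    ∑ = Sum.sum

    sgn : ∀ {n} → Fin n → Carrier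
    sgn j = (- 1#) ^ toℕ j

    Δ : ∀ {n} → Matrix n n → Carrier
    Δ = det

    ∑-cong : ∀ {n} {f g : Vector Carrier n} → (∀ i → f i ≈ g i) → ∑ f ≈ ∑ g
    ∑-cong = Sum.sum-cong-≋

    ∑-zero : (f : Vector Carrier zero) → ∑ f ≈ 0#
    ∑-zero f = refl

    ∑-suc : ∀ {n} (f : Vector Carrier (suc n)) → ∑ f ≈ f zero + ∑ (tail f)
    ∑-suc f = refl

    ∑-0# : ∀ n → ∑ {n} (λ _ → 0#) ≈ 0#
    ∑-0# = Sum.sum-replicate-zero

    ∑-+ : ∀ {n} (f g : Vector Carrier n) → ∑ (λ i → f i + g i) ≈ ∑ f + ∑ g
    ∑-+ = Sum.∑-distrib-+

    ∑-* : ∀ {n} x (f : Vector Carrier n) → ∑ (λ i → x * f i) ≈ x * ∑ f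
    ∑-* x f = sym (Sum.*-distribˡ-sum x f)

    ∑-comm : ∀ {m n} (f : Matrix m n) → ∑ (λ i → ∑ (f i)) ≈ ∑ (λ j → ∑ λ i → f i j)
    ∑-comm = Sum.∑-comm

    sgn-zero : ∀ {n} → sgn {suc n} zero ≈ 1#
    sgn-zero = refl

    sgn-suc : ∀ {n} (j : Fin n) → sgn (suc j) ≈ - 1# * sgn j
    sgn-suc j = refl

    sgn-↑ˡ : ∀ {p} q (j : Fin p) → sgn (j ↑ˡ q) ≈ sgn j
    sgn-↑ˡ q j = ^-congʳ (- 1#) (toℕ-↑ˡ j q)

    sgn² : ∀ {n} (j : Fin n) → sgn j * sgn j ≈ 1#
    sgn² j = ^-inverse -1²≈1 (toℕ j)

    Δ≈det : ∀ {n} (M : Matrix n n) → Δ M ≈ det M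
    Δ≈det M = refl

    Δ-zero : (M : Matrix zero zero) → Δ M ≈ 1#
    Δ-zero M = refl

    Δ-expand : ∀ {n} (M : Matrix (suc n) (suc n)) →
               Δ M ≈ ∑ λ j → sgn j * (M zero j * Δ (λ i l → M (suc i) (punchIn j l)))
    Δ-expand M = refl

    Δ-cong : ∀ {n} {M N : Matrix n n} → (∀ i j → M i j ≈ N i j) → Δ M ≈ Δ N
    Δ-cong {zero}          M≈N = refl
    Δ-cong {suc n} {M} {N} M≈N = ∑-cong
      {f = λ j → sgn j * (M zero j * Δ (λ i l → M (suc i) (punchIn j l)))}
      {g = λ j → sgn j * (N zero j * Δ (λ i l → N (suc i) (punchIn j l)))}
      λ j → *-cong (refl {sgn j}) (*-cong (M≈N zero j) (Δ-cong λ i l → M≈N (suc i) (punchIn j l)))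

  sgn-suc² : ∀ {m n} (j : Fin m) (k : Fin n) → sgn (suc j) * sgn (suc k) ≈ sgn j * sgn k
  sgn-suc² j k = begin
    sgn (suc j) * sgn (suc k)        ≈⟨ *-cong (sgn-suc j) (sgn-suc k) ⟩
    (- 1# * sgn j) * (- 1# * sgn k)  ≈⟨ solve 3 (λ e s t → (e :* s) :* (e :* t) := (e :* e) :* (s :* t)) refl _ _ _ ⟩
    (- 1# * - 1#) * (sgn j * sgn k)  ≈⟨ *-congʳ -1²≈1 ⟩
    1# * (sgn j * sgn k)             ≈⟨ *-identityˡ _ ⟩
    sgn j * sgn k                    ∎

  ∑≈0 : ∀ {n} {f : Vector Carrier n} → (∀ i → f i ≈ 0#) → ∑ f ≈ 0#
  ∑≈0 {n} f≈0 = trans (∑-cong f≈0) (∑-0# n)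

  ∑-split : ∀ p {q} (f : Vector Carrier (p ℕ.+ q)) →
            ∑ f ≈ ∑ (λ i → f (i ↑ˡ q)) + ∑ (λ i → f (p ↑ʳ i))
  ∑-split zero    f = sym (trans (+-congʳ (∑-zero _)) (+-identityˡ _))
  ∑-split (suc p) f = begin
    ∑ f                                                       ≈⟨ ∑-suc f ⟩
    f zero + ∑ (tail f)                                       ≈⟨ +-congˡ (∑-split p (tail f)) ⟩
    f zero + (∑ (λ i → f (suc i ↑ˡ _)) + ∑ (λ i → f (suc p ↑ʳ i)))  ≈⟨ +-assoc _ _ _ ⟨
    (f zero + ∑ (λ i → f (suc i ↑ˡ _))) + ∑ (λ i → f (suc p ↑ʳ i))  ≈⟨ +-congʳ (∑-suc _) ⟨
    ∑ (λ i → f (i ↑ˡ _)) + ∑ (λ i → f (suc p ↑ʳ i))           ∎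

  -- Linearity and alternation in the rows.

  deleteCol : ∀ {m n} → Fin (suc n) → Matrix m (suc n) → Matrix m n
  deleteCol j M i l = M i (punchIn j l)

  Δ-∷ : ∀ {n} u (M : Matrix n (suc n)) →
        Δ (u ∷ M) ≈ ∑ λ j → sgn j * (u j * Δ (deleteCol j M))
  Δ-∷ u M = Δ-expand (u ∷ M)

  -- The rows below `u` enter the expansion only through their minors. Inductions on the size change
  -- the lower rows by way of this.
  Δ-∷-cong : ∀ {n} u {M N : Matrix n (suc n)} →
             (∀ j → Δ (deleteCol j M) ≈ Δ (deleteCol j N)) → Δ (u ∷ M) ≈ Δ (u ∷ N)
  Δ-∷-cong u {M} {N} eq = trans (Δ-∷ u M) (trans (∑-cong λ j → *-congˡ (*-congˡ (eq j))) (sym (Δ-∷ u N)))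

  Δ-∷-η : ∀ {n} (M : Matrix (suc n) (suc n)) → Δ M ≈ Δ (head M ∷ tail M)
  Δ-∷-η M = Δ-cong λ { zero j → refl ; (suc i) j → refl }

  Δ-∷∷-η : ∀ {n} u (M : Matrix (suc n) (2 ℕ.+ n)) → Δ (u ∷ M) ≈ Δ (u ∷ head M ∷ tail M)
  Δ-∷∷-η u M = Δ-∷-cong u λ j → Δ-cong λ { zero j → refl ; (suc i) j → refl }

  deleteCol-∷ : ∀ {n} j u (M : Matrix n (2 ℕ.+ n)) →
                Δ (deleteCol j (u ∷ M)) ≈ Δ (removeAt u j ∷ deleteCol j M)
  deleteCol-∷ j u M = Δ-cong λ { zero l → refl ; (suc i) l → refl }

  Δ-linear : ∀ {n} u x v (M : Matrix n (suc n)) →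
             Δ ((λ l → u l + x * v l) ∷ M) ≈ Δ (u ∷ M) + x * Δ (v ∷ M)
  Δ-linear u x v M = begin
    Δ ((λ l → u l + x * v l) ∷ M)
      ≈⟨ Δ-∷ _ M ⟩
    ∑ (λ j → sgn j * ((u j + x * v j) * d j))
      ≈⟨ ∑-cong (λ j → solve 5 (λ s u x v d → s :* ((u :+ x :* v) :* d) := s :* (u :* d) :+ x :* (s :* (v :* d)))
                         refl (sgn j) (u j) x (v j) (d j)) ⟩
    ∑ (λ j → sgn j * (u j * d j) + x * (sgn j * (v j * d j)))
      ≈⟨ ∑-+ _ _ ⟩
    ∑ (λ j → sgn j * (u j * d j)) + ∑ (λ j → x * (sgn j * (v j * d j)))
      ≈⟨ +-cong (sym (Δ-∷ u M)) (trans (∑-* x _) (*-congˡ (sym (Δ-∷ v M)))) ⟩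
    Δ (u ∷ M) + x * Δ (v ∷ M) ∎
    where d = λ j → Δ (deleteCol j M)

  -- The iterated expansion along two rows u, v is this sum with b i j = u i * v j
  -- and F the minor on a set of columns.
  pairSum : ∀ {n} → (Fin (2 ℕ.+ n) → Fin (2 ℕ.+ n) → Carrier) →
            ((Fin n → Fin (2 ℕ.+ n)) → Carrier) → Carrier
  pairSum b F = ∑ λ j → ∑ λ k →
    (sgn j * sgn k) * (b j (punchIn j k) * F (punchIn j ∘ punchIn k))

  -- The pairs that contain column `zero` cancel. Choosing `zero` first and `suc k` second, or the
  -- reverse, leaves the same columns for `F` and gives equal values of the symmetric `b`, but
  -- opposite signs: `sgn k` against `- 1# * sgn k`.
  pairSum-suc : ∀ {n} b (F : (Fin n → Fin (2 ℕ.+ n)) → Carrier) → (∀ i j → b i j ≈ b j i) →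
    pairSum b F ≈ ∑ (λ (j : Fin (suc n)) → ∑ λ k → (sgn (suc j) * sgn (suc k)) *
      (b (suc j) (suc (punchIn j k)) * F (punchIn (suc j) ∘ punchIn (suc k))))
  pairSum-suc {n} b F b-sym = begin
    pairSum b F
      ≈⟨ trans (∑-suc _) (+-congˡ (∑-cong λ j → ∑-suc _)) ⟩
    ∑ X + ∑ (λ j → Y j + ∑ (Z j))
      ≈⟨ +-congˡ (∑-+ Y (λ j → ∑ (Z j))) ⟩
    ∑ X + (∑ Y + ∑ (λ j → ∑ (Z j)))
      ≈⟨ +-assoc _ _ _ ⟨
    (∑ X + ∑ Y) + ∑ (λ j → ∑ (Z j))
      ≈⟨ +-congʳ (trans (sym (∑-+ X Y)) (∑≈0 X+Y≈0)) ⟩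
    0# + ∑ (λ j → ∑ (Z j))
      ≈⟨ +-identityˡ _ ⟩
    ∑ (λ j → ∑ (Z j)) ∎
    where
    X Y : Fin (suc n) → Carrier
    X k = (sgn zero * sgn k) * (b zero (suc k) * F (suc ∘ punchIn k))
    Y j = (sgn (suc j) * sgn zero) * (b (suc j) zero * F (suc ∘ punchIn j))

    Z : Fin (suc n) → Fin n → Carrier
    Z j k = (sgn (suc j) * sgn (suc k)) *
            (b (suc j) (suc (punchIn j k)) * F (punchIn (suc j) ∘ punchIn (suc k)))

    X+Y≈0 : ∀ k → X k + Y k ≈ 0#
    X+Y≈0 k = begin
      X k + Y k
        ≈⟨ +-cong (*-congʳ (*-congʳ sgn-zero))
                  (*-cong (*-cong (sgn-suc k) sgn-zero) (*-congʳ (b-sym (suc k) zero))) ⟩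
      (1# * sgn k) * (b zero (suc k) * f) + ((- 1# * sgn k) * 1#) * (b zero (suc k) * f)
        -- The solver is one for semirings, so `- 1#` enters as an indeterminate `e`, and
        -- `1# + - 1#` is cancelled in a separate step. Later uses follow the same pattern.
        ≈⟨ solve 4 (λ e s b f → (con 1 :* s) :* (b :* f) :+ ((e :* s) :* con 1) :* (b :* f)
                             := (con 1 :+ e) :* (s :* (b :* f)))
             refl (- 1#) (sgn k) (b zero (suc k)) f ⟩
      (1# + - 1#) * (sgn k * (b zero (suc k) * f))
        ≈⟨ *-congʳ (-‿inverseʳ 1#) ⟩
      0# * (sgn k * (b zero (suc k) * f))
        ≈⟨ zeroˡ _ ⟩
      0# ∎
      where f = F (suc ∘ punchIn k)

  -- After `pairSum-suc` no chosen pair contains column `zero`, so shifting all indices gives a sum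
  -- of the same form one size down, in which `lift 1` keeps column `zero` among those passed to
  -- `F`. The function `F` is arbitrary because `minorOn M ∘ lift 1` is no longer of the form
  -- `minorOn`.
  pairSum-symmetric : ∀ {n} b (F : (Fin n → Fin (2 ℕ.+ n)) → Carrier) →
    (∀ {f g} → f ≗ g → F f ≈ F g) → (∀ i j → b i j ≈ b j i) → pairSum b F ≈ 0#
  pairSum-symmetric {zero} b F F-cong b-sym =
    trans (pairSum-suc b F b-sym) (∑≈0 λ j → ∑-zero _)
  pairSum-symmetric {suc n} b F F-cong b-sym = begin
    pairSum b F
      ≈⟨ pairSum-suc b F b-sym ⟩
    ∑ (λ j → ∑ λ k → (sgn (suc j) * sgn (suc k)) *
          (b (suc j) (suc (punchIn j k)) * F (punchIn (suc j) ∘ punchIn (suc k))))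
      ≈⟨ ∑-cong (λ j → ∑-cong λ k →
           *-cong (sgn-suc² j k) (*-congˡ (F-cong λ { zero → ≡.refl ; (suc l) → ≡.refl }))) ⟩
    pairSum (λ i j → b (suc i) (suc j)) (F ∘ lift 1)
      ≈⟨ pairSum-symmetric _ (F ∘ lift 1)
           (λ f≗g → F-cong λ { zero → ≡.refl ; (suc l) → ≡.cong suc (f≗g l) })
           (λ i j → b-sym (suc i) (suc j)) ⟩
    0# ∎

  minorOn : ∀ {m n} → Matrix m n → (Fin m → Fin n) → Carrier
  minorOn M f = Δ (λ i l → M i (f l))

  minorOn-cong : ∀ {m n} (M : Matrix m n) {f g} → f ≗ g → minorOn M f ≈ minorOn M g
  minorOn-cong M f≗g = Δ-cong λ i l → reflexive (≡.cong (M i) (f≗g l))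

  Δ-pairSum : ∀ {n} u v (M : Matrix n (2 ℕ.+ n)) →
              Δ (u ∷ v ∷ M) ≈ pairSum (λ i j → u i * v j) (minorOn M)
  Δ-pairSum u v M = trans (Δ-∷ u (v ∷ M)) (∑-cong λ j → begin
    sgn j * (u j * Δ (deleteCol j (v ∷ M)))
      ≈⟨ *-congˡ (*-congˡ (trans (deleteCol-∷ j v M) (Δ-∷ _ _))) ⟩
    sgn j * (u j * ∑ (G j))
      ≈⟨ *-assoc _ _ _ ⟨
    (sgn j * u j) * ∑ (G j)
      ≈⟨ ∑-* _ (G j) ⟨
    ∑ (λ k → (sgn j * u j) * G j k)
      ≈⟨ ∑-cong (λ k → solve 5 (λ s u t v f → (s :* u) :* (t :* (v :* f)) := (s :* t) :* ((u :* v) :* f))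
                         refl (sgn j) (u j) (sgn k) (v (punchIn j k)) (minorOn M (punchIn j ∘ punchIn k))) ⟩
    ∑ (λ k → (sgn j * sgn k) * ((u j * v (punchIn j k)) * minorOn M (punchIn j ∘ punchIn k))) ∎)
    where
    G = λ j k → sgn k * (v (punchIn j k) * minorOn M (punchIn j ∘ punchIn k))

  Δ-equal : ∀ {n} u (M : Matrix n (2 ℕ.+ n)) → Δ (u ∷ u ∷ M) ≈ 0#
  Δ-equal u M = trans (Δ-pairSum u u M)
    (pairSum-symmetric _ (minorOn M) (minorOn-cong M) λ i j → *-comm (u i) (u j))

  -- The sum of the two determinants is `pairSum` of `u i * v j + v i * u j`, which is symmetric in
  -- `i` and `j`.
  Δ-swap : ∀ {n} u v (M : Matrix n (2 ℕ.+ n)) → Δ (u ∷ v ∷ M) ≈ - Δ (v ∷ u ∷ M)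
  Δ-swap u v M = +-inverseˡ-unique _ _ (begin
    Δ (u ∷ v ∷ M) + Δ (v ∷ u ∷ M)
      ≈⟨ +-cong (Δ-pairSum u v M) (Δ-pairSum v u M) ⟩
    pairSum (λ i j → u i * v j) (minorOn M) + pairSum (λ i j → v i * u j) (minorOn M)
      ≈⟨ ∑-+ (λ j → ∑ (P u v j)) (λ j → ∑ (P v u j)) ⟨
    ∑ (λ j → ∑ (P u v j) + ∑ (P v u j))
      ≈⟨ ∑-cong (λ j → trans (sym (∑-+ (P u v j) (P v u j))) (∑-cong λ k →
           solve 4 (λ s b c f → s :* (b :* f) :+ s :* (c :* f) := s :* ((b :+ c) :* f))
             refl (sgn j * sgn k) (u j * v (punchIn j k)) (v j * u (punchIn j k)) (minorOn M (punchIn j ∘ punchIn k)))) ⟩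
    pairSum (λ i j → u i * v j + v i * u j) (minorOn M)
      ≈⟨ pairSum-symmetric _ (minorOn M) (minorOn-cong M)
           (λ i j → solve 4 (λ a b c d → a :* b :+ c :* d := d :* c :+ b :* a) refl (u i) (v j) (v i) (u j)) ⟩
    0# ∎)
    where
    P = λ u v j k → (sgn j * sgn k) * ((u j * v (punchIn j k)) * minorOn M (punchIn j ∘ punchIn k))

  -- If the copy of `u` is not directly below it, a swap puts `head M` on top. Expanding along that
  -- row leaves minors that still repeat the row `u`, with the copy one place nearer.
  Δ-repeated : ∀ {n} u (M : Matrix n (suc n)) j → (∀ l → M j l ≈ u l) → Δ (u ∷ M) ≈ 0#
  Δ-repeated {suc n} u M zero Mj≈u =
    trans (Δ-cong {N = u ∷ u ∷ tail M} λ { zero l → refl ; (suc zero) l → Mj≈u l ; (suc (suc i)) l → refl })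
          (Δ-equal u (tail M))
  Δ-repeated {suc n} u M (suc j) Mj≈u = begin
    Δ (u ∷ M)                  ≈⟨ Δ-∷∷-η u M ⟩
    Δ (u ∷ head M ∷ tail M)    ≈⟨ Δ-swap u (head M) (tail M) ⟩
    - Δ (head M ∷ u ∷ tail M)  ≈⟨ -‿cong (trans (Δ-∷ _ _) (∑≈0 minor≈0)) ⟩
    - 0#                       ≈⟨ -0#≈0# ⟩
    0#                         ∎
    where
    minor≈0 : ∀ k → sgn k * (head M k * Δ (deleteCol k (u ∷ tail M))) ≈ 0#
    minor≈0 k = begin
      sgn k * (head M k * Δ (deleteCol k (u ∷ tail M)))
        ≈⟨ *-congˡ (*-congˡ (trans (deleteCol-∷ k u (tail M))
             (Δ-repeated (removeAt u k) (deleteCol k (tail M)) j (Mj≈u ∘ punchIn k)))) ⟩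
      sgn k * (head M k * 0#)
        ≈⟨ trans (*-congˡ (zeroʳ _)) (zeroʳ _) ⟩
      0# ∎

  -- The second row is swapped to the top, where linearity splits off a determinant with two rows
  -- `u`. In the expansion along what remains of that row, `u` heads every minor, so induction
  -- clears the other rows.
  Δ-pivot : ∀ {n} u (x : Vector Carrier n) (M : Matrix n (suc n)) →
            Δ (u ∷ λ i l → M i l + x i * u l) ≈ Δ (u ∷ M)
  Δ-pivot {zero}  u x M = Δ-cong λ { zero l → refl }
  Δ-pivot {suc n} u x M = begin
    Δ (u ∷ λ i l → M i l + x i * u l)
      ≈⟨ Δ-∷∷-η u (λ i l → M i l + x i * u l) ⟩
    Δ (u ∷ (λ l → M zero l + x zero * u l) ∷ M′)
      ≈⟨ Δ-swap u _ M′ ⟩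
    - Δ ((λ l → M zero l + x zero * u l) ∷ u ∷ M′)
      ≈⟨ -‿cong (Δ-linear (M zero) (x zero) u (u ∷ M′)) ⟩
    - (Δ (M zero ∷ u ∷ M′) + x zero * Δ (u ∷ u ∷ M′))
      ≈⟨ -‿cong (+-cong (Δ-∷-cong (M zero) pivot-minor) (trans (*-congˡ (Δ-equal u M′)) (zeroʳ _))) ⟩
    - (Δ (M zero ∷ u ∷ tail M) + 0#)
      ≈⟨ -‿cong (+-identityʳ _) ⟩
    - Δ (M zero ∷ u ∷ tail M)
      ≈⟨ Δ-swap u (M zero) (tail M) ⟨
    Δ (u ∷ head M ∷ tail M)
      ≈⟨ Δ-∷∷-η u M ⟨
    Δ (u ∷ M) ∎
    where
    M′ : Matrix n (2 ℕ.+ n)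
    M′ i l = M (suc i) l + x (suc i) * u l

    pivot-minor : ∀ k → Δ (deleteCol k (u ∷ M′)) ≈ Δ (deleteCol k (u ∷ tail M))
    pivot-minor k = begin
      Δ (deleteCol k (u ∷ M′))
        ≈⟨ deleteCol-∷ k u M′ ⟩
      Δ (removeAt u k ∷ deleteCol k M′)
        ≈⟨ Δ-pivot (removeAt u k) (tail x) (deleteCol k (tail M)) ⟩
      Δ (removeAt u k ∷ deleteCol k (tail M))
        ≈⟨ deleteCol-∷ k u (tail M) ⟨
      Δ (deleteCol k (u ∷ tail M)) ∎

  -- Invariance under transposition.

  -- Expanding along the first row, and then each minor along its first column, gives `expand`: a
  -- corner term and a double sum over `i` and `j`. Transposition exchanges `i` and `j` in that sum,
  -- up to transposing minors two sizes down.
  Δ-transpose-step : ∀ {n} →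
    (∀ (N : Matrix (suc n) (suc n)) → Δ N ≈ Δ (transpose N)) →
    (∀ (N : Matrix n n) → Δ N ≈ Δ (transpose N)) →
    ∀ (M : Matrix (2 ℕ.+ n) (2 ℕ.+ n)) → Δ M ≈ Δ (transpose M)
  Δ-transpose-step {n} ih₁ ih₀ M = begin
    Δ M
      ≈⟨ expand M ⟩
    M zero zero * Δ (corner′ M) + ∑ (λ i → ∑ (term M i))
      ≈⟨ +-cong (*-congˡ (ih₁ (corner′ M))) (∑-comm (term M)) ⟩
    M zero zero * Δ (corner′ Mᵀ) + ∑ (λ j → ∑ λ i → term M i j)
      ≈⟨ +-congˡ (∑-cong λ j → ∑-cong λ i → trans (*-congˡ (ih₀ (minor² M i j)))
           (*-congʳ (solve 5 (λ e s t x y → (e :* (s :* t)) :* (x :* y) := (e :* (t :* s)) :* (y :* x))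
             refl (- 1#) (sgn i) (sgn j) (M (suc i) zero) (M zero (suc j))))) ⟩
    M zero zero * Δ (corner′ Mᵀ) + ∑ (λ i → ∑ (term Mᵀ i))
      ≈⟨ expand Mᵀ ⟨
    Δ Mᵀ ∎
    where
    Mᵀ = transpose M

    corner′ : Matrix (2 ℕ.+ n) (2 ℕ.+ n) → Matrix (suc n) (suc n)
    corner′ N i j = N (suc i) (suc j)

    minor² : Matrix (2 ℕ.+ n) (2 ℕ.+ n) → Fin (suc n) → Fin (suc n) → Matrix n n
    minor² N i j k l = N (suc (punchIn i k)) (suc (punchIn j l))

    term : Matrix (2 ℕ.+ n) (2 ℕ.+ n) → Fin (suc n) → Fin (suc n) → Carrier
    term N i j = (- 1# * (sgn i * sgn j)) * (N (suc i) zero * N zero (suc j)) * Δ (minor² N i j)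

    -- Expansion along a column is available only one size down, as the row expansion of the
    -- transpose. Column `zero` survives in this minor because the struck column is `suc j`.
    expandCol : ∀ N j → Δ (deleteCol (suc j) (tail N)) ≈ ∑ λ i → sgn i * (N (suc i) zero * Δ (minor² N i j))
    expandCol N j = begin
      Δ (deleteCol (suc j) (tail N))
        ≈⟨ ih₁ (deleteCol (suc j) (tail N)) ⟩
      Δ (transpose (deleteCol (suc j) (tail N)))
        ≈⟨ Δ-expand _ ⟩
      ∑ (λ i → sgn i * (N (suc i) zero * Δ (transpose (minor² N i j))))
        ≈⟨ ∑-cong (λ i → *-congˡ (*-congˡ (ih₀ (minor² N i j)))) ⟨
      ∑ (λ i → sgn i * (N (suc i) zero * Δ (minor² N i j))) ∎

    expand : ∀ N → Δ N ≈ N zero zero * Δ (corner′ N) + ∑ (λ i → ∑ (term N i))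
    expand N = begin
      Δ N
        ≈⟨ trans (Δ-expand N) (∑-suc _) ⟩
      sgn zero * (N zero zero * Δ (corner′ N)) +
        ∑ (λ j → sgn (suc j) * (N zero (suc j) * Δ (deleteCol (suc j) (tail N))))
        ≈⟨ +-cong (trans (*-congʳ sgn-zero) (*-identityˡ _)) (∑-cong λ j → begin
             sgn (suc j) * (N zero (suc j) * Δ (deleteCol (suc j) (tail N)))
               ≈⟨ *-cong (sgn-suc j) (*-congˡ (expandCol N j)) ⟩
             (- 1# * sgn j) * (N zero (suc j) * ∑ (λ i → sgn i * (N (suc i) zero * Δ (minor² N i j))))
               ≈⟨ *-assoc _ _ _ ⟨
             (- 1# * sgn j) * N zero (suc j) * ∑ (λ i → sgn i * (N (suc i) zero * Δ (minor² N i j)))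
               ≈⟨ ∑-* _ _ ⟨
             ∑ (λ i → (- 1# * sgn j) * N zero (suc j) * (sgn i * (N (suc i) zero * Δ (minor² N i j))))
               ≈⟨ ∑-cong (λ i → solve 6 (λ e t y s x d →
                    (e :* t) :* y :* (s :* (x :* d)) := (e :* (s :* t)) :* (x :* y) :* d)
                    refl (- 1#) (sgn j) (N zero (suc j)) (sgn i) (N (suc i) zero) (Δ (minor² N i j))) ⟩
             ∑ (λ i → term N i j) ∎) ⟩
      N zero zero * Δ (corner′ N) + ∑ (λ j → ∑ λ i → term N i j)
        ≈⟨ +-congˡ (∑-comm (term N)) ⟨
      N zero zero * Δ (corner′ N) + ∑ (λ i → ∑ (term N i)) ∎

  Δ-transpose : ∀ {n} (M : Matrix n n) → Δ M ≈ Δ (transpose M)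
  Δ-transpose {zero}        M = Δ-cong λ ()
  Δ-transpose {suc zero}    M = Δ-cong λ { zero zero → refl }
  Δ-transpose {suc (suc n)} M = Δ-transpose-step Δ-transpose Δ-transpose M

  -- Scaling, and row operations between stacked matrices.

  Δ-scale : ∀ {n} x (M : Matrix n n) → Δ (λ i j → x * M i j) ≈ x ^ n * Δ M
  Δ-scale {zero}  x M = trans (Δ-cong λ ()) (sym (*-identityˡ _))
  Δ-scale {suc n} x M = begin
    Δ (λ i j → x * M i j)
      ≈⟨ Δ-expand _ ⟩
    ∑ (λ j → sgn j * ((x * M zero j) * Δ (λ i l → x * M (suc i) (punchIn j l))))
      ≈⟨ ∑-cong (λ j → trans (*-congˡ (*-congˡ (Δ-scale x (λ i l → M (suc i) (punchIn j l)))))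
           (solve 5 (λ s x m y d → s :* ((x :* m) :* (y :* d)) := (x :* y) :* (s :* (m :* d)))
             refl (sgn j) x (M zero j) (x ^ n) (Δ (λ i l → M (suc i) (punchIn j l))))) ⟩
    ∑ (λ j → x ^ suc n * (sgn j * (M zero j * Δ (λ i l → M (suc i) (punchIn j l)))))
      ≈⟨ trans (∑-* _ _) (*-congˡ (sym (Δ-expand M))) ⟩
    x ^ suc n * Δ M ∎

  Δ-++-suc : ∀ {p q} (A : Matrix (suc p) (suc p ℕ.+ q)) (B : Matrix q (suc p ℕ.+ q)) →
             Δ (A ++ B) ≈ Δ (head A ∷ (tail A ++ B))
  Δ-++-suc A B = Δ-cong λ
    { zero l → refl
    ; (suc i) l → reflexive (≡.cong (λ row → row l) (tail-++ A B i)) }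

  deleteCol-++ : ∀ {p q} k (A : Matrix p (suc (p ℕ.+ q))) (B : Matrix q (suc (p ℕ.+ q))) →
                 Δ (deleteCol k (A ++ B)) ≈ Δ (deleteCol k A ++ deleteCol k B)
  deleteCol-++ {p} k A B = Δ-cong entry
    where
    entry : ∀ i l → deleteCol k (A ++ B) i l ≈ (deleteCol k A ++ deleteCol k B) i l
    entry i l with splitAt p i
    ... | inj₁ _ = refl
    ... | inj₂ _ = refl

  -- Linearity in the first row splits off a determinant whose top row reappears inside `B`, hence
  -- zero. The remaining rows of `A` are treated in the minors. A general `σ` lets the induction
  -- pass to `σ ∘ suc`; on Ω it is the identity.
  Δ-addBelow : ∀ {p q} x (σ : Fin p → Fin q) (A : Matrix p (p ℕ.+ q)) B →
               Δ ((λ i l → A i l + x * B (σ i) l) ++ B) ≈ Δ (A ++ B)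
  Δ-addBelow {zero}  x σ A B = Δ-cong λ i l → refl
  Δ-addBelow {suc p} x σ A B = begin
    Δ (A′ ++ B)
      ≈⟨ Δ-++-suc A′ B ⟩
    Δ (head A′ ∷ (tail A′ ++ B))
      ≈⟨ Δ-linear (head A) x (B (σ zero)) (tail A′ ++ B) ⟩
    Δ (head A ∷ (tail A′ ++ B)) + x * Δ (B (σ zero) ∷ (tail A′ ++ B))
      ≈⟨ +-cong (Δ-∷-cong (head A) minor) (*-congˡ (Δ-repeated _ (tail A′ ++ B) (p ↑ʳ σ zero)
           λ l → reflexive (≡.cong (λ row → row l) (lookup-++ʳ (tail A′) B (σ zero))))) ⟩
    Δ (head A ∷ (tail A ++ B)) + x * 0#
      ≈⟨ trans (+-congˡ (zeroʳ x)) (+-identityʳ _) ⟩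
    Δ (head A ∷ (tail A ++ B))
      ≈⟨ Δ-++-suc A B ⟨
    Δ (A ++ B) ∎
    where
    A′ = λ i l → A i l + x * B (σ i) l

    minor : ∀ k → Δ (deleteCol k (tail A′ ++ B)) ≈ Δ (deleteCol k (tail A ++ B))
    minor k = begin
      Δ (deleteCol k (tail A′ ++ B))
        ≈⟨ deleteCol-++ k (tail A′) B ⟩
      Δ (deleteCol k (tail A′) ++ deleteCol k B)
        ≈⟨ Δ-addBelow x (σ ∘ suc) (deleteCol k (tail A)) (deleteCol k B) ⟩
      Δ (deleteCol k (tail A) ++ deleteCol k B)
        ≈⟨ deleteCol-++ k (tail A) B ⟨
      Δ (deleteCol k (tail A ++ B)) ∎

  -- Induction on the rows of `A`: `Δ-pivot` removes the multiples of `head A`, and the minors take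
  -- care of the rest. Each step drops a row of `A` but none of `B`, so the coefficients form a
  -- rectangular matrix `c`.
  Δ-addAbove : ∀ {p q} (c : Matrix q p) (A : Matrix p (p ℕ.+ q)) B →
               Δ (A ++ (λ j l → B j l + ∑ λ i → c j i * A i l)) ≈ Δ (A ++ B)
  Δ-addAbove {zero}  c A B = Δ-cong λ i l → trans (+-congˡ (∑-zero _)) (+-identityʳ _)
  Δ-addAbove {suc p} {q} c A B = begin
    Δ (A ++ B′)
      ≈⟨ Δ-++-suc A B′ ⟩
    Δ (head A ∷ (tail A ++ B′))
      ≈⟨ Δ-cong (λ { zero l → refl ; (suc i) l → separate i l }) ⟩
    Δ (head A ∷ λ i l → (tail A ++ B″) i l + c₀ i * head A l)
      ≈⟨ Δ-pivot (head A) c₀ (tail A ++ B″) ⟩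
    Δ (head A ∷ (tail A ++ B″))
      ≈⟨ Δ-∷-cong (head A) minor ⟩
    Δ (head A ∷ (tail A ++ B))
      ≈⟨ Δ-++-suc A B ⟨
    Δ (A ++ B) ∎
    where
    B′ B″ : Matrix q (suc p ℕ.+ q)
    B′ j l = B j l + ∑ λ i → c j i * A i l
    B″ j l = B j l + ∑ λ i → c j (suc i) * A (suc i) l

    -- The coefficients are zero on the rows of `tail A`, so that the pivot changes only the rows of
    -- `B″`.
    c₀ : Vector Carrier (p ℕ.+ q)
    c₀ = (λ (_ : Fin p) → 0#) ++ (λ j → c j zero)

    separate : ∀ i l → (tail A ++ B′) i l ≈ (tail A ++ B″) i l + c₀ i * head A l
    separate i l with splitAt p i
    ... | inj₁ i = sym (trans (+-congˡ (zeroˡ _)) (+-identityʳ _))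
    ... | inj₂ j = trans (+-congˡ (∑-suc _))
      (solve 3 (λ x y z → x :+ (y :+ z) := (x :+ z) :+ y) refl _ _ _)

    minor : ∀ k → Δ (deleteCol k (tail A ++ B″)) ≈ Δ (deleteCol k (tail A ++ B))
    minor k = begin
      Δ (deleteCol k (tail A ++ B″))
        ≈⟨ deleteCol-++ k (tail A) B″ ⟩
      Δ (deleteCol k (tail A) ++ deleteCol k B″)
        ≈⟨ Δ-addAbove (λ j i → c j (suc i)) (deleteCol k (tail A)) (deleteCol k B) ⟩
      Δ (deleteCol k (tail A) ++ deleteCol k B)
        ≈⟨ deleteCol-++ k (tail A) B ⟨
      Δ (deleteCol k (tail A ++ B)) ∎

  -- Unit vectors and block triangular matrices.

  unit : ∀ {n} → Fin n → Vector Carrier n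
  unit j i = if does (i ≟ j) then 1# else 0#

  ∑-unit : ∀ {n} (j : Fin n) f → ∑ (λ i → unit j i * f i) ≈ f j
  ∑-unit zero f = begin
    ∑ (λ i → unit zero i * f i)                ≈⟨ ∑-suc _ ⟩
    1# * f zero + ∑ (λ i → 0# * f (suc i))     ≈⟨ +-cong (*-identityˡ _) (∑≈0 λ i → zeroˡ _) ⟩
    f zero + 0#                                ≈⟨ +-identityʳ _ ⟩
    f zero                                     ∎
  ∑-unit (suc j) f = begin
    ∑ (λ i → unit (suc j) i * f i)                 ≈⟨ ∑-suc _ ⟩
    0# * f zero + ∑ (λ i → unit j i * f (suc i))   ≈⟨ +-cong (zeroˡ _) (∑-unit j (tail f)) ⟩
    0# + f (suc j)                                 ≈⟨ +-identityˡ _ ⟩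
    f (suc j)                                      ∎

  Δ-unit : ∀ {n} (j : Fin (suc n)) M → Δ (unit j ∷ M) ≈ sgn j * Δ (deleteCol j M)
  Δ-unit j M = begin
    Δ (unit j ∷ M)
      ≈⟨ Δ-∷ (unit j) M ⟩
    ∑ (λ i → sgn i * (unit j i * Δ (deleteCol i M)))
      ≈⟨ ∑-cong (λ i → solve 3 (λ s u d → s :* (u :* d) := u :* (s :* d)) refl _ _ _) ⟩
    ∑ (λ i → unit j i * (sgn i * Δ (deleteCol i M)))
      ≈⟨ ∑-unit j _ ⟩
    sgn j * Δ (deleteCol j M) ∎

  -- The case of `Δ-addAbove` where `c` is `y` times the identity matrix. Between two transpositions
  -- it becomes the column operation on Ω.
  Δ-addAbove-diagonal : ∀ {n} y (A B : Matrix n (n ℕ.+ n)) →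
                        Δ (A ++ (λ j l → B j l + y * A j l)) ≈ Δ (A ++ B)
  Δ-addAbove-diagonal {n} y A B =
    trans (Δ-cong entry) (Δ-addAbove (λ j i → y * unit j i) A B)
    where
    entry : ∀ i l → (A ++ (λ j l → B j l + y * A j l)) i l ≈
                    (A ++ (λ j l → B j l + ∑ λ i → (y * unit j i) * A i l)) i l
    entry i l with splitAt n i
    ... | inj₁ _ = refl
    ... | inj₂ j = +-congˡ (sym (trans (∑-cong λ i → *-assoc _ _ _)
                     (trans (∑-* y _) (*-congˡ (∑-unit j λ i → A i l)))))

  -- In the expansion along the first row the columns of `B` contribute zero. A column of `A` leaves
  -- a minor of the same block form with `D` unchanged, so `Δ D` factors out by induction on `p`.
  Δ-blockLower : ∀ {p q} (A : Matrix p p) (B : Matrix p q) (C : Matrix q p) (D : Matrix q q) →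
                 (∀ i j → B i j ≈ 0#) → Δ (block A B C D) ≈ Δ A * Δ D
  Δ-blockLower {zero} A B C D B≈0 =
    trans (Δ-cong λ i j → refl) (sym (trans (*-congʳ (Δ-zero A)) (*-identityˡ _)))
  Δ-blockLower {suc p} {q} A B C D B≈0 = begin
    Δ M
      ≈⟨ Δ-expand M ⟩
    ∑ f
      ≈⟨ ∑-split (suc p) f ⟩
    ∑ (λ j → f (j ↑ˡ q)) + ∑ (λ j → f (suc p ↑ʳ j))
      ≈⟨ +-cong (∑-cong left) (∑≈0 right) ⟩
    ∑ (λ j → (sgn j * (A zero j * Δ (deleteCol j (tail A)))) * Δ D) + 0#
      ≈⟨ +-identityʳ _ ⟩
    ∑ (λ j → (sgn j * (A zero j * Δ (deleteCol j (tail A)))) * Δ D)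
      ≈⟨ trans (∑-cong λ j → *-comm _ _) (trans (∑-* (Δ D) _) (*-comm _ _)) ⟩
    ∑ (λ j → sgn j * (A zero j * Δ (deleteCol j (tail A)))) * Δ D
      ≈⟨ *-congʳ (Δ-expand A) ⟨
    Δ A * Δ D ∎
    where
    M = block A B C D

    f : Vector Carrier (suc p ℕ.+ q)
    f j = sgn j * ((A zero ++ B zero) j * Δ (deleteCol j (tail M)))

    entry : ∀ j i l → M (suc i) (punchIn (j ↑ˡ q) l) ≈
                      block (deleteCol j (tail A)) (tail B) (deleteCol j C) D i l
    entry j i l with splitAt p i
    ... | inj₁ i = reflexive (removeAt-++ (A (suc i)) (B (suc i)) j l)
    ... | inj₂ i = reflexive (removeAt-++ (C i) (D i) j l)

    left : ∀ j → f (j ↑ˡ q) ≈ (sgn j * (A zero j * Δ (deleteCol j (tail A)))) * Δ D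
    left j = begin
      f (j ↑ˡ q)
        ≈⟨ *-cong (sgn-↑ˡ q j) (*-cong (reflexive (lookup-++ˡ (A zero) (B zero) j))
             (trans (Δ-cong (entry j))
                    (Δ-blockLower (deleteCol j (tail A)) (tail B) (deleteCol j C) D (B≈0 ∘ suc)))) ⟩
      sgn j * (A zero j * (Δ (deleteCol j (tail A)) * Δ D))
        ≈⟨ solve 4 (λ s a d e → s :* (a :* (d :* e)) := (s :* (a :* d)) :* e) refl _ _ _ _ ⟩
      (sgn j * (A zero j * Δ (deleteCol j (tail A)))) * Δ D ∎

    right : ∀ j → f (suc p ↑ʳ j) ≈ 0#
    right j = begin
      f (suc p ↑ʳ j)
        ≈⟨ *-congˡ (*-congʳ (trans (reflexive (lookup-++ʳ (A zero) (B zero) j)) (B≈0 zero j))) ⟩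
      sgn (suc p ↑ʳ j) * (0# * Δ (deleteCol (suc p ↑ʳ j) (tail M)))
        ≈⟨ trans (*-congˡ (zeroˡ _)) (zeroʳ _) ⟩
      0# ∎

  -- The symmetric matrix C and the skew-symmetric matrices E and Ω.

  tridiagonal-sym : ∀ {n} (a : Vector Carrier n) i j → tridiagonal a i j ≈ tridiagonal a j i
  tridiagonal-sym a i j
    with ∣ toℕ i - toℕ j ∣ in eq | ∣ toℕ j - toℕ i ∣ | ∣-∣-comm (toℕ i) (toℕ j)
  ... | 0           | _ | ≡.refl = reflexive (≡.cong a (toℕ-injective (∣m-n∣≡0⇒m≡n eq)))
  ... | 1           | _ | ≡.refl = refl
  ... | suc (suc _) | _ | ≡.refl = refl

  -- The source of the subtracted continuant: C without its first and last rows and columns. Here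
  -- `punchIn (fromℕ m)` acts as `inject₁`, and neither `inject₁` nor a common `suc` changes the
  -- distance of two indices.
  tridiagonal-interior : ∀ {m} (a : Vector Carrier (2 ℕ.+ m)) i j →
    tridiagonal a (suc (punchIn (fromℕ m) i)) (suc (punchIn (fromℕ m) j)) ≈
    tridiagonal (init (tail a)) i j
  tridiagonal-interior {m} a i j
    rewrite punchIn-fromℕ i | punchIn-fromℕ j | toℕ-inject₁ i | toℕ-inject₁ j
    with ∣ toℕ i - toℕ j ∣
  ... | 0           = refl
  ... | 1           = refl
  ... | suc (suc _) = refl

  corner-skew : ∀ m i j → corner m i j ≈ - corner m j i
  corner-skew m zero    zero    = sym -0#≈0#
  corner-skew m zero    (suc j) with does (suc j ≟ fromℕ (suc m))
  ... | true  = sym (-‿involutive 1#)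
  ... | false = sym -0#≈0#
  corner-skew m (suc i) zero    with does (suc i ≟ fromℕ (suc m))
  ... | true  = refl
  ... | false = sym -0#≈0#
  corner-skew m (suc i) (suc j) = sym -0#≈0#

  Ω-skew : ∀ {m} (a : Vector Carrier (2 ℕ.+ m)) → SkewSymmetric (Ω a)
  Ω-skew {m} a i j with splitAt (2 ℕ.+ m) i in eq
  ... | inj₁ i′ with splitAt (2 ℕ.+ m) j
  ...   | inj₁ j′ rewrite eq = corner-skew m i′ j′
  ...   | inj₂ j′ rewrite eq = trans (tridiagonal-sym a i′ j′) (sym (-‿involutive _))
  Ω-skew {m} a i j | inj₂ i′ with splitAt (2 ℕ.+ m) j
  ...   | inj₁ j′ rewrite eq = -‿cong (tridiagonal-sym a i′ j′)
  ...   | inj₂ j′ rewrite eq = corner-skew m i′ j′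

  -- Evaluation over a ring with a square root of -1.

  module SquareRootOf-1 {m} (a : Vector Carrier (2 ℕ.+ m)) where

    private
      C E : Matrix (2 ℕ.+ m) (2 ℕ.+ m)
      C = tridiagonal a
      E = corner m

      K₀ K₂ : Carrier
      K₀ = Δ C
      K₂ = Δ (tridiagonal (init (tail a)))

      n : ℕ
      n = 2 ℕ.+ m

      l : Fin n
      l = fromℕ (suc m)

      l′ : Fin (suc m)
      l′ = fromℕ m

    -- Splitting the first row and the first column yields four terms. Those of degree one in `w`
    -- both involve `p`, the minor of C without its first row and last column; symmetry of C
    -- identifies it with the minor at the opposite corner.
    Δ-C+wE : ∀ {w} → w * w ≈ - 1# → Δ (λ i j → C i j + w * E i j) ≈ rotundus a
    Δ-C+wE {w} w²≈-1 = begin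
      Δ Q
        ≈⟨ Δ-∷-η Q ⟩
      Δ (head Q ∷ tail Q)
        -- By definition the first row of `E` is `unit l`.
        ≈⟨ Δ-linear (head C) w (unit l) (tail Q) ⟩
      Δ (head C ∷ tail Q) + w * Δ (unit l ∷ tail Q)
        ≈⟨ +-cong first (*-congˡ second) ⟩
      (K₀ + (w * - 1#) * (sgn l * p)) + w * (sgn l * (p + (w * - 1#) * (sgn l′ * K₂)))
        ≈⟨ +-cong (+-congˡ (*-congˡ (*-congʳ (sgn-suc l′)))) (*-congˡ (*-congʳ (sgn-suc l′))) ⟩
      (K₀ + (w * e) * ((e * t) * p)) + w * ((e * t) * (p + (w * e) * (t * K₂)))
        -- With `sgn l` rewritten as `e * t`, the two terms in `p` collect the factor `1# + e`,
        -- which is zero. In the quadratic term `e * e` and `t * t` are both one, which leaves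
        -- `w * w * K₂`.
        ≈⟨ solve 6 (λ k w e t p q →
             (k :+ (w :* e) :* ((e :* t) :* p)) :+ w :* ((e :* t) :* (p :+ (w :* e) :* (t :* q)))
             := k :+ ((con 1 :+ e) :* (w :* e :* t :* p) :+ (w :* w) :* ((e :* e) :* ((t :* t) :* q))))
             refl K₀ w e t p K₂ ⟩
      K₀ + ((1# + e) * (w * e * t * p) + (w * w) * ((e * e) * ((t * t) * K₂)))
        ≈⟨ +-congˡ (+-cong (trans (*-congʳ (-‿inverseʳ 1#)) (zeroˡ _))
             (*-cong w²≈-1 (trans (*-cong -1²≈1 (trans (*-congʳ (sgn² l′)) (*-identityˡ _))) (*-identityˡ _)))) ⟩
      K₀ + (0# + - 1# * K₂)
        ≈⟨ +-congˡ (trans (+-identityˡ _) (-1*x≈-x K₂)) ⟩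
      K₀ - K₂
        ≈⟨ +-cong (Δ≈det C) (-‿cong (Δ≈det (tridiagonal (init (tail a))))) ⟩
      rotundus a ∎
      where
      e = - 1#
      t = sgn l′

      Q : Matrix n n
      Q i j = C i j + w * E i j

      P : Matrix (suc m) (suc m)
      P = deleteCol l (tail C)

      p : Carrier
      p = Δ P

      -- Below the diagonal the first column of `E` is `unit l` negated. This is what the
      -- transpositions in `first` and `second` turn into a row.
      E-zero : ∀ j → w * E (suc j) zero ≈ (w * - 1#) * unit l (suc j)
      E-zero j with does (suc j ≟ l)
      ... | true  = sym (*-identityʳ _)
      ... | false = trans (zeroʳ w) (sym (zeroʳ _))

      Q-suc : ∀ i j → Q (suc i) (suc j) ≈ C (suc i) (suc j)
      Q-suc i j = trans (+-congˡ (zeroʳ w)) (+-identityʳ _)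

      first : Δ (head C ∷ tail Q) ≈ K₀ + (w * - 1#) * (sgn l * p)
      first = begin
        Δ (head C ∷ tail Q)
          ≈⟨ Δ-transpose (head C ∷ tail Q) ⟩
        Δ (transpose (head C ∷ tail Q))
          ≈⟨ Δ-cong entry ⟩
        Δ ((λ j → C zero j + (w * - 1#) * unit l j) ∷ tail C)
          ≈⟨ Δ-linear (head C) (w * - 1#) (unit l) (tail C) ⟩
        Δ (head C ∷ tail C) + (w * - 1#) * Δ (unit l ∷ tail C)
          ≈⟨ +-cong (sym (Δ-∷-η C)) (*-congˡ (Δ-unit l (tail C))) ⟩
        K₀ + (w * - 1#) * (sgn l * p) ∎
        where
        entry : ∀ i j → transpose (head C ∷ tail Q) i j ≈
                        ((λ j → C zero j + (w * - 1#) * unit l j) ∷ tail C) i j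
        entry zero    zero    = sym (trans (+-congˡ (zeroʳ _)) (+-identityʳ _))
        entry zero    (suc j) = +-cong (tridiagonal-sym a (suc j) zero) (E-zero j)
        entry (suc i) zero    = tridiagonal-sym a zero (suc i)
        entry (suc i) (suc j) = trans (Q-suc j i) (tridiagonal-sym a (suc j) (suc i))

      second : Δ (unit l ∷ tail Q) ≈ sgn l * (p + (w * - 1#) * (sgn l′ * K₂))
      second = begin
        Δ (unit l ∷ tail Q)
          ≈⟨ Δ-unit l (tail Q) ⟩
        sgn l * Δ (deleteCol l (tail Q))
          ≈⟨ *-congˡ (Δ-transpose (deleteCol l (tail Q))) ⟩
        sgn l * Δ (transpose (deleteCol l (tail Q)))
          ≈⟨ *-congˡ (Δ-cong entry) ⟩
        sgn l * Δ ((λ i → P i zero + (w * - 1#) * unit l′ i) ∷ tail (transpose P))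
          ≈⟨ *-congˡ (Δ-linear (head (transpose P)) (w * - 1#) (unit l′) (tail (transpose P))) ⟩
        sgn l * (Δ (head (transpose P) ∷ tail (transpose P)) +
                 (w * - 1#) * Δ (unit l′ ∷ tail (transpose P)))
          ≈⟨ *-congˡ (+-cong (trans (sym (Δ-∷-η (transpose P))) (sym (Δ-transpose P)))
               (*-congˡ (trans (Δ-unit l′ (tail (transpose P))) (*-congˡ (Δ-cong interior))))) ⟩
        sgn l * (p + (w * - 1#) * (sgn l′ * K₂)) ∎
        where
        entry : ∀ i j → transpose (deleteCol l (tail Q)) i j ≈
                        ((λ i → P i zero + (w * - 1#) * unit l′ i) ∷ tail (transpose P)) i j
        entry zero    j = +-congˡ (E-zero j)
        entry (suc i) j = Q-suc j (punchIn l′ i)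

        interior : ∀ i j → deleteCol l′ (tail (transpose P)) i j ≈ tridiagonal (init (tail a)) i j
        interior i j = trans (tridiagonal-sym a (suc (punchIn l′ j)) (suc (punchIn l′ i)))
                             (tridiagonal-interior a i j)

    Δ-Ω : ∀ {w} → w * w ≈ - 1# → Δ (Ω a) ≈ rotundus a * rotundus a
    Δ-Ω {w} w²≈-1 = begin
      Δ (A ++ B)
        ≈⟨ Δ-addBelow w id A B ⟨
      Δ (A′ ++ B)
        ≈⟨ Δ-transpose (A′ ++ B) ⟩
      Δ (transpose (A′ ++ B))
        ≈⟨ Δ-cong transposed ⟩
      Δ (S ++ T)
        ≈⟨ Δ-addAbove-diagonal y S T ⟨
      Δ (S ++ T′)
        ≈⟨ Δ-transpose (S ++ T′) ⟩
      Δ (transpose (S ++ T′))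
        ≈⟨ Δ-cong triangular ⟩
      Δ (block U (λ _ _ → 0#) (mapᴹ (λ x → - x) C) W)
        ≈⟨ Δ-blockLower U (λ _ _ → 0#) (mapᴹ (λ x → - x) C) W (λ _ _ → refl) ⟩
      Δ U * Δ W
        ≈⟨ *-cong (Δ-cong U≈) (Δ-cong W≈) ⟩
      Δ (λ i j → y * (C i j + w * E i j)) * Δ (λ i j → w * (C i j + y * E i j))
        -- Both `w` and `y` are square roots of -1, so each factor yields the same rotundus. The
        -- powers `y ^ n` and `w ^ n` then cancel because `y * w` is one.
        ≈⟨ *-cong (trans (Δ-scale y _) (*-congˡ (Δ-C+wE w²≈-1)))
                  (trans (Δ-scale w _) (*-congˡ (Δ-C+wE y²≈-1))) ⟩
      (y ^ n * r) * (w ^ n * r)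
        ≈⟨ solve 3 (λ a b r → (a :* r) :* (b :* r) := (a :* b) :* (r :* r)) refl _ _ _ ⟩
      (y ^ n * w ^ n) * (r * r)
        ≈⟨ trans (*-congʳ (^-inverse yw≈1 n)) (*-identityˡ _) ⟩
      r * r ∎
      where
      r = rotundus a
      -- This is -w, which is also the inverse of `w`.
      y = w * - 1#

      yw≈1 : y * w ≈ 1#
      yw≈1 = begin
        (w * - 1#) * w  ≈⟨ solve 2 (λ w e → (w :* e) :* w := (w :* w) :* e) refl w (- 1#) ⟩
        (w * w) * - 1#  ≈⟨ *-congʳ w²≈-1 ⟩
        - 1# * - 1#     ≈⟨ -1²≈1 ⟩
        1#              ∎

      y²≈-1 : y * y ≈ - 1#
      y²≈-1 = begin
        y * (w * - 1#)  ≈⟨ *-assoc _ _ _ ⟨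
        (y * w) * - 1#  ≈⟨ *-congʳ yw≈1 ⟩
        1# * - 1#       ≈⟨ *-identityˡ _ ⟩
        - 1#            ∎

      -- `A` and `B` are the upper and lower halves of Ω, and `A′` is the upper half after the row
      -- operation. `S` and `T` are the left and right halves of the result, transposed, and `T′` is
      -- the right half after the column operation.
      A B A′ S T T′ : Matrix n (n ℕ.+ n)
      A = zipWith _++_ E C
      B = zipWith _++_ (mapᴹ (λ x → - x) C) E
      A′ i k = A i k + w * B i k
      S i = (λ j → E j i + w * - C j i) ++ (λ j → - C j i)
      T i = (λ j → C j i + w * E j i) ++ (λ j → E j i)
      T′ i k = T i k + y * S i k

      U W : Matrix n n
      U i j = E i j + w * - C i j
      W i j = E i j + y * - C i j

      transposed : ∀ i j → transpose (A′ ++ B) i j ≈ (S ++ T) i j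
      transposed i j with splitAt n i in eq
      ... | inj₁ i′ with splitAt n j
      ...   | inj₁ j′ rewrite eq = refl
      ...   | inj₂ j′ rewrite eq = refl
      transposed i j | inj₂ i′ with splitAt n j
      ...   | inj₁ j′ rewrite eq = refl
      ...   | inj₂ j′ rewrite eq = refl

      -- As `y` is -w, the terms in E cancel and C + w²C remains.
      topRight≈0 : ∀ i j → (C i j + w * E i j) + y * (E i j + w * - C i j) ≈ 0#
      topRight≈0 i j = begin
        (Cᵢⱼ + w * Eᵢⱼ) + (w * - 1#) * (Eᵢⱼ + w * - Cᵢⱼ)
          ≈⟨ +-congˡ (*-congˡ (+-congˡ (*-congˡ (-1*x≈-x Cᵢⱼ)))) ⟨
        (Cᵢⱼ + w * Eᵢⱼ) + (w * - 1#) * (Eᵢⱼ + w * (- 1# * Cᵢⱼ))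
          ≈⟨ solve 4 (λ w ε Cᵢⱼ Eᵢⱼ →
               (Cᵢⱼ :+ w :* Eᵢⱼ) :+ (w :* ε) :* (Eᵢⱼ :+ w :* (ε :* Cᵢⱼ))
               := (con 1 :+ ε) :* (w :* Eᵢⱼ) :+ (Cᵢⱼ :+ (w :* w) :* ((ε :* ε) :* Cᵢⱼ))) refl w (- 1#) Cᵢⱼ Eᵢⱼ ⟩
        (1# + - 1#) * (w * Eᵢⱼ) + (Cᵢⱼ + (w * w) * ((- 1# * - 1#) * Cᵢⱼ))
          ≈⟨ +-cong (trans (*-congʳ (-‿inverseʳ 1#)) (zeroˡ _))
               (+-congˡ (*-cong w²≈-1 (trans (*-congʳ -1²≈1) (*-identityˡ Cᵢⱼ)))) ⟩
        0# + (Cᵢⱼ + - 1# * Cᵢⱼ)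
          ≈⟨ trans (+-identityˡ _) (+-congˡ (-1*x≈-x Cᵢⱼ)) ⟩
        Cᵢⱼ - Cᵢⱼ
          ≈⟨ -‿inverseʳ Cᵢⱼ ⟩
        0# ∎
        where
        Cᵢⱼ = C i j
        Eᵢⱼ = E i j

      triangular : ∀ i j → transpose (S ++ T′) i j ≈
                           block U (λ _ _ → 0#) (mapᴹ (λ x → - x) C) W i j
      triangular i j with splitAt n i in eq
      ... | inj₁ i′ with splitAt n j
      ...   | inj₁ j′ rewrite eq = refl
      ...   | inj₂ j′ rewrite eq = topRight≈0 i′ j′
      triangular i j | inj₂ i′ with splitAt n j
      ...   | inj₁ j′ rewrite eq = refl
      ...   | inj₂ j′ rewrite eq = refl

      -- Here `v` is both the inverse and the negative of `u`, so E - vC equals uvE + uC. The pair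
      -- `u`, `v` is `y`, `w` for `U` and `w`, `y` for `W`.
      factor : ∀ {u v} → u * v ≈ 1# → v ≈ u * - 1# → ∀ i j →
               E i j + v * - C i j ≈ u * (C i j + v * E i j)
      factor {u} {v} uv≈1 v≈-u i j = begin
        Eᵢⱼ + v * - Cᵢⱼ
          ≈⟨ +-cong (sym (trans (*-congʳ uv≈1) (*-identityˡ Eᵢⱼ)))
                    (*-cong v≈-u (sym (-1*x≈-x Cᵢⱼ))) ⟩
        (u * v) * Eᵢⱼ + (u * - 1#) * (- 1# * Cᵢⱼ)
          ≈⟨ solve 5 (λ u v ε Cᵢⱼ Eᵢⱼ → (u :* v) :* Eᵢⱼ :+ (u :* ε) :* (ε :* Cᵢⱼ)
                                 := u :* ((ε :* ε) :* Cᵢⱼ :+ v :* Eᵢⱼ)) refl u v (- 1#) Cᵢⱼ Eᵢⱼ ⟩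
        u * ((- 1# * - 1#) * Cᵢⱼ + v * Eᵢⱼ)
          ≈⟨ *-congˡ (+-congʳ (trans (*-congʳ -1²≈1) (*-identityˡ Cᵢⱼ))) ⟩
        u * (Cᵢⱼ + v * Eᵢⱼ) ∎
        where
        Cᵢⱼ = C i j
        Eᵢⱼ = E i j

      w≈-y : w ≈ y * - 1#
      w≈-y = sym (trans (*-assoc w _ _) (trans (*-congˡ -1²≈1) (*-identityʳ w)))

      U≈ : ∀ i j → U i j ≈ y * (C i j + w * E i j)
      U≈ = factor yw≈1 w≈-y

      W≈ : ∀ i j → W i j ≈ w * (C i j + y * E i j)
      W≈ = factor (trans (*-comm w y) yw≈1) refl

-- The quadratic extension R[x]/(x² - d).

module QuadraticExtension {c ℓ} (R : CommutativeRing c ℓ) (d : CommutativeRing.Carrier R) where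

  open CommutativeRing R hiding (zero)
  open import Algebra.Solver.Ring.NaturalCoefficients.Default commutativeSemiring
    using (solve; _:=_; _:+_; _:*_; con)

  -- (x , y) stands for x + y √d.
  _⊗_ : Carrier × Carrier → Carrier × Carrier → Carrier × Carrier
  (x , y) ⊗ (x′ , y′) = x * x′ + d * (y * y′) , x * y′ + y * x′

  -- Built as the free module on 1 and √d with componentwise equality, so that an equation between
  -- values of `ι` has an equation in `R` as its first component.
  R[√d] : CommutativeRing c ℓ
  R[√d] = record
    { _+_ = AbelianGroup._∙_ R² ; _*_ = _⊗_ ; -_ = AbelianGroup._⁻¹ R²
    ; 0# = 0# , 0# ; 1# = 1# , 0#
    ; isCommutativeRing = record
      { isRing = record
        { +-isAbelianGroup = AbelianGroup.isAbelianGroup R²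
        ; *-cong = λ (x≈ , y≈) (x′≈ , y′≈) →
            +-cong (*-cong x≈ x′≈) (*-congˡ (*-cong y≈ y′≈)) , +-cong (*-cong x≈ y′≈) (*-cong y≈ x′≈)
        ; *-assoc = λ (a , b) (c , d′) (e , f) →
              solve 7 (λ δ a b c d e f →
                (a :* c :+ δ :* (b :* d)) :* e :+ δ :* ((a :* d :+ b :* c) :* f)
                := a :* (c :* e :+ δ :* (d :* f)) :+ δ :* (b :* (c :* f :+ d :* e))) refl d a b c d′ e f
            , solve 7 (λ δ a b c d e f →
                (a :* c :+ δ :* (b :* d)) :* f :+ (a :* d :+ b :* c) :* e
                := a :* (c :* f :+ d :* e) :+ b :* (c :* e :+ δ :* (d :* f))) refl d a b c d′ e f
        ; *-identity =
              (λ (a , b) → solve 3 (λ δ a b → con 1 :* a :+ δ :* (con 0 :* b) := a) refl d a b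
                         , solve 2 (λ a b → con 1 :* b :+ con 0 :* a := b) refl a b)
            , (λ (a , b) → solve 3 (λ δ a b → a :* con 1 :+ δ :* (b :* con 0) := a) refl d a b
                         , solve 2 (λ a b → a :* con 0 :+ b :* con 1 := b) refl a b)
        ; distrib =
              (λ (a , b) (c , d′) (e , f) →
                  solve 7 (λ δ a b c d e f → a :* (c :+ e) :+ δ :* (b :* (d :+ f))
                    := (a :* c :+ δ :* (b :* d)) :+ (a :* e :+ δ :* (b :* f))) refl d a b c d′ e f
                , solve 6 (λ a b c d e f → a :* (d :+ f) :+ b :* (c :+ e)
                    := (a :* d :+ b :* c) :+ (a :* f :+ b :* e)) refl a b c d′ e f)
            , (λ (a , b) (c , d′) (e , f) →
                  solve 7 (λ δ a b c d e f → (c :+ e) :* a :+ δ :* ((d :+ f) :* b)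
                    := (c :* a :+ δ :* (d :* b)) :+ (e :* a :+ δ :* (f :* b))) refl d a b c d′ e f
                , solve 6 (λ a b c d e f → (c :+ e) :* b :+ (d :+ f) :* a
                    := (c :* b :+ d :* a) :+ (e :* b :+ f :* a)) refl a b c d′ e f)
        }
      ; *-comm = λ (a , b) (c , d′) →
            solve 5 (λ δ a b c d → a :* c :+ δ :* (b :* d) := c :* a :+ δ :* (d :* b)) refl d a b c d′
          , solve 4 (λ a b c d → a :* d :+ b :* c := c :* b :+ d :* a) refl a b c d′
      }
    }
    where R² = DirectProduct.abelianGroup +-abelianGroup +-abelianGroup

  open CommutativeRing R[√d] using () renaming (_≈_ to _≈′_; _*_ to _*′_; rawRing to rawRing′)

  √d : Carrier × Carrier
  √d = 0# , 1#

  ι : Carrier → Carrier × Carrier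
  ι x = x , 0#

  √d² : (√d *′ √d) ≈′ ι d
  √d² = solve 1 (λ d → con 0 :* con 0 :+ d :* (con 1 :* con 1) := d) refl d
      , solve 0 (con 0 :* con 1 :+ con 1 :* con 0 := con 0) refl

  ι-isRingHomomorphism : IsRingHomomorphism rawRing rawRing′ ι
  ι-isRingHomomorphism = record
    { isSemiringHomomorphism = record
      { isNearSemiringHomomorphism = record
        { +-isMonoidHomomorphism = record
          { isMagmaHomomorphism = record
            { isRelHomomorphism = record { cong = λ x≈y → x≈y , refl }
            ; homo = λ x y → refl , sym (+-identityˡ 0#)
            }
          ; ε-homo = refl , refl
          }
        ; *-homo = λ x y →
            solve 3 (λ d x y → x :* y := x :* y :+ d :* (con 0 :* con 0)) refl d x y
          , solve 2 (λ x y → con 0 := x :* con 0 :+ con 0 :* y) refl x y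
        }
      ; 1#-homo = refl , refl
      }
    ; -‿homo = λ x → refl , sym -0#≈0#
    }
    where open import Algebra.Properties.Ring ring using (-0#≈0#)

-- Compatibility of determinants with ring homomorphisms.

module Homomorphism {c₁ ℓ₁ c₂ ℓ₂} (R : CommutativeRing c₁ ℓ₁) (S : CommutativeRing c₂ ℓ₂)
  {φ} (φ-homo : IsRingHomomorphism (CommutativeRing.rawRing R) (CommutativeRing.rawRing S) φ) where

  private
    module R where
      open CommutativeRing R public
      open Rotundus R public
      open import Algebra.Properties.Semiring.Sum semiring public using (sum)

  open CommutativeRing S hiding (zero)
  open Rotundus S
  open import Algebra.Properties.Semiring.Sum semiring using (sum; sum-cong-≋)
  open IsRingHomomorphism φ-homo
  open import Relation.Binary.Reasoning.Setoid setoid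

  sum-homo : ∀ {n} (f : Vector R.Carrier n) → φ (R.sum f) ≈ sum (φ ∘ f)
  sum-homo {zero}  f = 0#-homo
  sum-homo {suc n} f = trans (+-homo _ _) (+-congˡ (sum-homo (tail f)))

  -1^-homo : ∀ n → φ ((R.- R.1#) R.^ n) ≈ (- 1#) ^ n
  -1^-homo zero    = 1#-homo
  -1^-homo (suc n) = trans (*-homo _ _) (*-cong (trans (-‿homo _) (-‿cong 1#-homo)) (-1^-homo n))

  -- The target `N` is any matrix entrywise equal to the image of `M`: the image of `Ω a` agrees
  -- with `Ω (φ ∘ a)` only up to `≈`, since 0, 1 and negatives must be carried across.
  det-homo : ∀ {n} (M : R.Matrix n n) (N : Matrix n n) → (∀ i j → φ (M i j) ≈ N i j) →
             φ (R.det M) ≈ det N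
  det-homo {zero}  M N φM≈N = 1#-homo
  det-homo {suc n} M N φM≈N = trans (sum-homo f) (sum-cong-≋ {x = φ ∘ f} {y = g} λ j →
    trans (*-homo _ _) (*-cong (-1^-homo (toℕ j)) (trans (*-homo _ _)
      (*-cong (φM≈N zero j) (det-homo _ _ λ i l → φM≈N (suc i) (punchIn j l))))))
    where
    f : Vector R.Carrier (suc n)
    f j = ((R.- R.1#) R.^ toℕ j) R.* (M zero j R.* R.det (λ i l → M (suc i) (punchIn j l)))

    g : Vector Carrier (suc n)
    g j = ((- 1#) ^ toℕ j) * (N zero j * det (λ i l → N (suc i) (punchIn j l)))

  tridiagonal-homo : ∀ {n} (a : Vector R.Carrier n) i j →
                     φ (R.tridiagonal a i j) ≈ tridiagonal (φ ∘ a) i j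
  tridiagonal-homo a i j with ∣ toℕ i - toℕ j ∣
  ... | 0           = refl
  ... | 1           = 1#-homo
  ... | suc (suc _) = 0#-homo

  corner-homo : ∀ m i j → φ (R.corner m i j) ≈ corner m i j
  corner-homo m zero    j with does (j ≟ fromℕ (suc m))
  ... | true  = 1#-homo
  ... | false = 0#-homo
  corner-homo m (suc i) zero with does (suc i ≟ fromℕ (suc m))
  ... | true  = trans (-‿homo _) (-‿cong 1#-homo)
  ... | false = 0#-homo
  corner-homo m (suc i) (suc j) = 0#-homo

  Ω-homo : ∀ {m} (a : Vector R.Carrier (2 ℕ.+ m)) i j → φ (R.Ω a i j) ≈ Ω (φ ∘ a) i j
  Ω-homo {m} a i j with splitAt (2 ℕ.+ m) i
  ... | inj₁ i′ with splitAt (2 ℕ.+ m) j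
  ...   | inj₁ j′ = corner-homo m i′ j′
  ...   | inj₂ j′ = tridiagonal-homo a i′ j′
  Ω-homo {m} a i j | inj₂ i′ with splitAt (2 ℕ.+ m) j
  ...   | inj₁ j′ = trans (-‿homo _) (-‿cong (tridiagonal-homo a i′ j′))
  ...   | inj₂ j′ = corner-homo m i′ j′

  rotundus-homo : ∀ {m} (a : Vector R.Carrier (2 ℕ.+ m)) → φ (R.rotundus a) ≈ rotundus (φ ∘ a)
  rotundus-homo a = trans (+-homo _ _) (+-cong
    (det-homo _ _ (tridiagonal-homo a))
    (trans (-‿homo _) (-‿cong (det-homo _ _ (tridiagonal-homo (init (tail a)))))))

-- Descent to an arbitrary commutative ring.

theorem1 : ∀ {c ℓ} (R : CommutativeRing c ℓ) (m : ℕ) →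
    let open CommutativeRing R
        open Rotundus R in
    (a : Vector Carrier (2 ℕ.+ m)) →
    SkewSymmetric (Ω a) × (det (Ω a) ≈ rotundus a ^ 2)
-- The chain takes place in R[√-1] between two values of `ι`; `proj₁` is the injectivity of `ι`.
theorem1 R m a = Determinant.Ω-skew R a , proj₁ (begin
  ι (det (Ω a))
    ≈⟨ det-homo (Ω a) (Rotundus.Ω S (ι ∘ a)) (Ω-homo a) ⟩
  Rotundus.det S (Rotundus.Ω S (ι ∘ a))
    ≈⟨ S.sym (Δ≈det (Rotundus.Ω S (ι ∘ a))) ⟩
  Δ (Rotundus.Ω S (ι ∘ a))
    ≈⟨ SquareRootOf-1.Δ-Ω (ι ∘ a) √d²≈-1 ⟩
  Rotundus.rotundus S (ι ∘ a) S.* Rotundus.rotundus S (ι ∘ a)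
    ≈⟨ S.*-cong (rotundus-homo a) (rotundus-homo a) ⟨
  ι (rotundus a) S.* ι (rotundus a)
    ≈⟨ *-homo (rotundus a) (rotundus a) ⟨
  ι (rotundus a * rotundus a)
    -- `rotundus a ^ 2` unfolds to `rotundus a * (rotundus a * 1#)`.
    ≈⟨ ⟦⟧-cong (*-congˡ (*-identityʳ (rotundus a))) ⟨
  ι (rotundus a ^ 2) ∎)
  where
  open CommutativeRing R
  open Rotundus R
  open QuadraticExtension R (- 1#)
  S = R[√d]
  module S = CommutativeRing S
  open Determinant S using (Δ; Δ≈det; module SquareRootOf-1)
  open Homomorphism R S ι-isRingHomomorphism
  open IsRingHomomorphism ι-isRingHomomorphism using (*-homo; ⟦⟧-cong; -‿homo)
  open import Relation.Binary.Reasoning.Setoid S.setoid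

  √d²≈-1 : √d S.* √d S.≈ S.- S.1#
  √d²≈-1 = S.trans √d² (-‿homo 1#)
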